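{- Let $t$ be a domino tiling of the infinite square lattice $\mathbb{Z}^2$. Then exactly one of the following applies: (1) $t$ admits a flip; (2) $t$ consists entirely of parallel, doubly-infinite domino staircases; (3) $t$ is a windmill tiling.
   Context: A domino is the union of two unit squares $[i,i+1]\times[j,j+1]$ ($i,j\in\mathbb{Z}$) sharing a side; it is horizontal or vertical. A tiling of $\mathbb{Z}^2$ is a set of dominoes with pairwise disjoint interiors covering $\mathbb{R}^2$. Flip: $t$ admits a flip if two parallel dominoes of $t$ together form a $2\times2$ square (the flip replaces them by the other two-domino tiling of that square). Doubly-infinite domino staircase: a set of dominoes of the form $\{D+k s: k\in\mathbb{Z}\}$ where $D$ is a domino and $s\in\{(1,1),(1,-1)\}$ (so all dominoes are horizontal or all are vertical, and consecutive dominoes touch along exactly one unit edge of their longer sides). Two such staircases are parallel if they have the same $s$. "$t$ consists entirely of parallel, doubly-infinite domino staircases" means that the set of dominoes of $t$ is a disjoint union of doubly-infinite domino staircases all having the same $s$ (horizontal and vertical staircases may both occur). Windmill tilings: for a unit square $S=[a,a+1]\times[b,b+1]$ define the cardinal rugged quadrants with tip $S$, together with their (unique) tilings: - north $N(S)=\bigcup_{i\in\mathbb{Z}}[a+i,a+i+1]\times[b+|i|,\infty)$, tiled by the vertical dominoes $[a+i,a+i+1]\times[b+|i|+2k,b+|i|+2k+2]$, $i\in\mathbb{Z}$, $k\ge0$; - south: the region and tiling obtained from the north quadrant $N(S)$ by the reflection $y\mapsto 2b+1-y$ (vertical dominoes, tip $S$, opening downward); - east $E(S)=\bigcup_{j\in\mathbb{Z}}[a+|j|,\infty)\times[b+j,b+j+1]$,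 tiled by the horizontal dominoes $[a+|j|+2k,a+|j|+2k+2]\times[b+j,b+j+1]$, $j\in\mathbb{Z}$, $k\ge 0$; - west: the region and tiling obtained from the east quadrant $E(S)$ by the reflection $x\mapsto 2a+1-x$ (horizontal dominoes, tip $S$, opening to the left). A windmill tiling is a tiling of $\mathbb{Z}^2$ which, for some point $p\in\mathbb{Z}^2$, is the union of the tilings of four cardinal rugged quadrants, one of each kind, whose tips are the four unit squares around $p$, in one of the following two arrangements: (i) north tip = upper-left square, east tip = upper-right square, south tip = lower-right square, west tip = lower-left square; (ii) north tip = upper-right square, east tip = lower-right square, south tip = lower-left square, west tip = upper-left square. (In each arrangement the four quadrants have disjoint interiors and cover the plane.) -}

module Defs where

open import Data.Integer using (ℤ; +_; _+_; _-_; _*_; ∣_∣; 0ℤ; 1ℤ; -1ℤ)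
open import Data.Nat using (ℕ)
open import Data.Product using (_×_; _,_; ∃₂; ∃-syntax; Σ-syntax)
open import Data.Sum using (_⊎_)
open import Level using (0ℓ; suc)
open import Relation.Binary.PropositionalEquality using (_≡_; _≢_)
open import Relation.Unary using (Pred; _∈_; _∪_; _⊥_; _≐_; ｛_｝)

Point : Set
Point = ℤ × ℤ

infixl 6 _⊕_
_⊕_ : Point → Point → Point
(x , y) ⊕ (u , v) = (x + u , y + v)

infixr 7 _•_
_•_ : ℤ → Point → Point
k • (u , v) = (k * u , k * v)

-- The square (i , j) is [i , i+1] × [j , j+1].
Square : Set
Square = ℤ × ℤ

data Orientation : Set where
  horizontal vertical : Orientation

axis : Orientation → Point
axis horizontal = (1ℤ , 0ℤ)
axis vertical   = (0ℤ , 1ℤ)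

-- The corner is the lower-left one, so every domino of the lattice has exactly
-- one representation and propositional equality is equality of dominoes.
record Domino : Set where
  constructor domino
  field
    orientation : Orientation
    corner      : Point

open Domino public

squares : Domino → Pred Square 0ℓ
squares (domino o c) = ｛ c ｝ ∪ ｛ c ⊕ axis o ｝

-- Dominoes are unions of lattice squares: their interiors are disjoint exactly
-- when they have no square in common, and they cover ℝ² exactly when they
-- cover every lattice square.
record IsTiling (t : Pred Domino 0ℓ) : Set where
  field
    disjoint : ∀ {D E} → D ∈ t → E ∈ t → D ≢ E → squares D ⊥ squares E
    covering : ∀ (S : Square) → ∃[ D ] D ∈ t × S ∈ squares D

block : Point → Pred Square 0ℓ
block c = ｛ c ｝ ∪ ｛ c ⊕ (1ℤ , 0ℤ) ｝ ∪ ｛ c ⊕ (0ℤ , 1ℤ) ｝ ∪ ｛ c ⊕ (1ℤ , 1ℤ) ｝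

AdmitsFlip : Pred Domino 0ℓ → Set
AdmitsFlip t = ∃₂ λ D E → D ∈ t × E ∈ t × orientation D ≡ orientation E ×
  ∃[ c ] squares D ∪ squares E ≐ block c

data Slope : Set where
  rising falling : Slope

step : Slope → Point
step rising  = (1ℤ , 1ℤ)
step falling = (1ℤ , -1ℤ)

translate : Point → Domino → Domino
translate v (domino o c) = domino o (c ⊕ v)

staircase : Slope → Domino → Pred Domino 0ℓ
staircase s D E = ∃[ k ] E ≡ translate (k • step s) D

-- The staircases in the union are given by a set of dominoes containing one
-- domino from each of them.
ConsistsOfParallelStaircases : Pred Domino 0ℓ → Set (suc 0ℓ)
ConsistsOfParallelStaircases t =
  Σ[ s ∈ Slope ] Σ[ B ∈ Pred Domino 0ℓ ]
    (∀ {D E} → D ∈ B → E ∈ B → D ≢ E → staircase s D ⊥ staircase s E) ×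
    t ≐ (λ E → ∃[ D ] D ∈ B × E ∈ staircase s D)

-- Image of a domino under x ↦ 2a+1−x.  An interval [x , x+w] goes to
-- [2a+1−w−x , 2a+1−x], whose left end depends on the width w.
reflectX : ℤ → Domino → Domino
reflectX a (domino horizontal (x , y)) = domino horizontal (+ 2 * a - 1ℤ - x , y)
reflectX a (domino vertical   (x , y)) = domino vertical   (+ 2 * a - x , y)

-- Image of a domino under y ↦ 2b+1−y.
reflectY : ℤ → Domino → Domino
reflectY b (domino horizontal (x , y)) = domino horizontal (x , + 2 * b - y)
reflectY b (domino vertical   (x , y)) = domino vertical   (x , + 2 * b - 1ℤ - y)

-- The tilings of the cardinal rugged quadrants with a given tip.
north south east west : Square → Pred Domino 0ℓ
north (a , b) D = Σ[ i ∈ ℤ ] Σ[ k ∈ ℕ ]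
  D ≡ domino vertical (a + i , b + + ∣ i ∣ + + 2 * + k)
south (a , b) D = ∃[ E ] E ∈ north (a , b) × D ≡ reflectY b E
east  (a , b) D = Σ[ j ∈ ℤ ] Σ[ k ∈ ℕ ]
  D ≡ domino horizontal (a + + ∣ j ∣ + + 2 * + k , b + j)
west  (a , b) D = ∃[ E ] E ∈ east (a , b) × D ≡ reflectX a E

upperLeft upperRight lowerLeft lowerRight : Point → Square
upperLeft  p = p ⊕ (-1ℤ , 0ℤ)
upperRight p = p
lowerLeft  p = p ⊕ (-1ℤ , -1ℤ)
lowerRight p = p ⊕ (0ℤ , -1ℤ)

windmill₁ windmill₂ : Point → Pred Domino 0ℓ
windmill₁ p = north (upperLeft p) ∪ east (upperRight p)
            ∪ south (lowerRight p) ∪ west (lowerLeft p)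
windmill₂ p = north (upperRight p) ∪ east (lowerRight p)
            ∪ south (lowerLeft p) ∪ west (upperLeft p)

IsWindmill : Pred Domino 0ℓ → Set
IsWindmill t = ∃[ p ] (t ≐ windmill₁ p ⊎ t ≐ windmill₂ p)

{-# OPTIONS --safe #-}

-- In a flip-free tiling, if a domino lacks its parallel neighbour along one of
-- the two diagonal directions, then a vertical and a horizontal domino meet
-- there, and the pair forces the same pair one step further along the other
-- diagonal, and so on for ever.  Followed backwards, the line of such pairs
-- either continues for ever as well or starts at the four tips of a windmill,
-- and the tips force the rest of that windmill.  Without a windmill, defects
-- along both diagonals would give two perpendicular bi-infinite lines, each made
-- of two diagonals of vertical and two of horizontal squares, and they would
-- disagree where they cross.  So the tiling is invariant under one of the two
-- diagonal steps.
module Submission where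

open import Defs
open import Axiom.ExcludedMiddle using (ExcludedMiddle)
open import Data.Empty using (⊥-elim) renaming (⊥ to Empty)
open import Data.Integer using (ℤ; +_; -[1+_]; _+_; _-_; _*_; -_; ∣_∣; 0ℤ; 1ℤ; -1ℤ; suc; pred)
open import Data.Integer.Properties using
  ( suc-pred; pred-suc; neg-involutive; ∣-i∣≡∣i∣; i≢suc[i]; +-comm; +-assoc; +-inverseʳ
  ; neg-suc; pos-* )
open import Data.Integer.Tactic.RingSolver using (solve-∀)
open import Data.Nat as ℕ using (ℕ)
import Data.Nat.Properties as ℕ
open import Data.Product using (_×_; _,_; proj₁; proj₂; map₂; ∃₂; ∃-syntax)
open import Data.Sum as Sum using (_⊎_; inj₁; inj₂)
open import Function using (_∘_)
open import Level using (0ℓ)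
open import Relation.Binary.Definitions using (Tri; tri<; tri≈; tri>)
open import Relation.Binary.PropositionalEquality
  using (_≡_; _≢_; refl; sym; trans; cong; cong₂; subst)
open import Relation.Nullary using (¬_; yes; no; contradiction)
open import Relation.Unary using (Pred; _∈_; _∪_; _⊆_; _≐_; _⊥_)

-- Direction fields and their symmetries

data Direction : Set where
  up down left right : Direction

clash : ∀ {d a b : Direction} → d ≡ a → d ≡ b → a ≢ b → Empty
clash p q a≢b = a≢b (trans (sym p) q)

is-up : ∀ {d} → d ≢ down → d ≢ left → d ≢ right → d ≡ up
is-up {up}    _ _ _ = refl
is-up {down}  p _ _ = contradiction refl p
is-up {left}  _ p _ = contradiction refl p
is-up {right} _ _ p = contradiction refl p

is-down : ∀ {d} → d ≢ up → d ≢ left → d ≢ right → d ≡ down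
is-down {up}    p _ _ = contradiction refl p
is-down {down}  _ _ _ = refl
is-down {left}  _ p _ = contradiction refl p
is-down {right} _ _ p = contradiction refl p

is-left : ∀ {d} → d ≢ up → d ≢ down → d ≢ right → d ≡ left
is-left {up}    p _ _ = contradiction refl p
is-left {down}  _ p _ = contradiction refl p
is-left {left}  _ _ _ = refl
is-left {right} _ _ p = contradiction refl p

is-right : ∀ {d} → d ≢ up → d ≢ down → d ≢ left → d ≡ right
is-right {up}    p _ _ = contradiction refl p
is-right {down}  _ p _ = contradiction refl p
is-right {left}  _ _ p = contradiction refl p
is-right {right} _ _ _ = refl

IsHorizontal IsVertical : Direction → Set
IsHorizontal d = d ≡ right ⊎ d ≡ left
IsVertical   d = d ≡ up ⊎ d ≡ down

¬horizontal×vertical : ∀ {d} → IsHorizontal d → IsVertical d → Empty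
¬horizontal×vertical (inj₁ refl) (inj₁ ())
¬horizontal×vertical (inj₁ refl) (inj₂ ())
¬horizontal×vertical (inj₂ refl) (inj₁ ())
¬horizontal×vertical (inj₂ refl) (inj₂ ())

mirror transpose : Direction → Direction
mirror up    = up
mirror down  = down
mirror left  = right
mirror right = left
transpose up    = right
transpose down  = left
transpose left  = down
transpose right = up

mirror-involutive : ∀ d → mirror (mirror d) ≡ d
mirror-involutive up    = refl
mirror-involutive down  = refl
mirror-involutive left  = refl
mirror-involutive right = refl

transpose-involutive : ∀ d → transpose (transpose d) ≡ d
transpose-involutive up    = refl
transpose-involutive down  = refl
transpose-involutive left  = refl
transpose-involutive right = refl

unmirror : ∀ {d e} → mirror d ≡ e → d ≡ mirror e
unmirror {d} p = trans (sym (mirror-involutive d)) (cong mirror p)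

untranspose : ∀ {d e} → transpose d ≡ e → d ≡ transpose e
untranspose {d} p = trans (sym (transpose-involutive d)) (cong transpose p)

-- A tiling as the assignment to each square of the direction in which the
-- other square of its domino lies.
Field : Set
Field = ℤ → ℤ → Direction

at : ∀ (f : Field) {x x′ y y′ d} → x ≡ x′ → y ≡ y′ → f x y ≡ d → f x′ y′ ≡ d
at f refl refl p = p

record Matching (f : Field) : Set where
  field
    right⇒left : ∀ {x y} → f x y ≡ right → f (suc x) y ≡ left
    left⇒right : ∀ {x y} → f x y ≡ left → f (pred x) y ≡ right
    up⇒down    : ∀ {x y} → f x y ≡ up → f x (suc y) ≡ down
    down⇒up    : ∀ {x y} → f x y ≡ down → f x (pred y) ≡ up

-- A flip is recorded only at the left squares of two stacked horizontal dominoes, or at the lower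
-- squares of two adjacent vertical ones. The `left` and `down` versions follow through the
-- matching.
record FlipFree (f : Field) : Set where
  field
    matching : Matching f
    ¬right²  : ∀ {x y} → f x y ≡ right → f x (suc y) ≢ right
    ¬up²     : ∀ {x y} → f x y ≡ up → f (suc x) y ≢ up
  open Matching matching public

shift : ℤ → ℤ → Field → Field
shift a b f x y = f (a + x) (b + y)

-- `antitransposed` is the reflection taking `(x , y)` to `(- y , - x)`. It exchanges the two
-- orientations but maps every diagonal with `x - y` constant to itself, so a statement about
-- vertical dominoes along a diagonal yields the one about horizontal dominoes.
mirrored transposed antitransposed : Field → Field
mirrored f x y = mirror (f (- x) y)
transposed f x y = transpose (f y x)
antitransposed f = mirrored (transposed (mirrored f))

+-sucʳ : ∀ a x → a + (1ℤ + x) ≡ 1ℤ + (a + x)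
+-sucʳ = solve-∀

+-predʳ : ∀ a x → a + (-1ℤ + x) ≡ -1ℤ + (a + x)
+-predʳ = solve-∀

-‿suc : ∀ x → - (1ℤ + x) ≡ -1ℤ + (- x)
-‿suc = solve-∀

-‿pred : ∀ x → - (-1ℤ + x) ≡ 1ℤ + (- x)
-‿pred = solve-∀

+-assocʳ : ∀ a x u → a + (x + u) ≡ a + x + u
+-assocʳ = solve-∀

shift-flipFree : ∀ a b {f} → FlipFree f → FlipFree (shift a b f)
shift-flipFree a b {f} φ = record
  { matching = record
    { right⇒left = λ {x} p → at f (sym (+-sucʳ a x)) refl (right⇒left p)
    ; left⇒right = λ {x} p → at f (sym (+-predʳ a x)) refl (left⇒right p)
    ; up⇒down    = λ {_} {y} p → at f refl (sym (+-sucʳ b y)) (up⇒down p)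
    ; down⇒up    = λ {_} {y} p → at f refl (sym (+-predʳ b y)) (down⇒up p)
    }
  ; ¬right² = λ {_} {y} p q → ¬right² p (at f refl (+-sucʳ b y) q)
  ; ¬up²    = λ {x} p q → ¬up² p (at f (+-sucʳ a x) refl q)
  }
  where open FlipFree φ

mirrored-flipFree : ∀ {f} → FlipFree f → FlipFree (mirrored f)
mirrored-flipFree {f} φ = record
  { matching = record
    { right⇒left = λ {x} p →
        cong mirror (at f (sym (-‿suc x)) refl (left⇒right (unmirror p)))
    ; left⇒right = λ {x} p →
        cong mirror (at f (sym (-‿pred x)) refl (right⇒left (unmirror p)))
    ; up⇒down    = λ p → cong mirror (up⇒down (unmirror p))
    ; down⇒up    = λ p → cong mirror (down⇒up (unmirror p))
    }
  ; ¬right² = λ p q →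
      ¬right² (left⇒right (unmirror p)) (left⇒right (unmirror q))
  -- The reflection reverses left and right, so the square of `q` is now the left one.
  ; ¬up²    = λ {x} p q →
      ¬up² (at f (-‿suc x) refl (unmirror q))
           (at f (sym (suc-pred (- x))) refl (unmirror p))
  }
  where open FlipFree φ

transposed-flipFree : ∀ {f} → FlipFree f → FlipFree (transposed f)
transposed-flipFree φ = record
  { matching = record
    { right⇒left = λ p → cong transpose (up⇒down (untranspose p))
    ; left⇒right = λ p → cong transpose (down⇒up (untranspose p))
    ; up⇒down    = λ p → cong transpose (right⇒left (untranspose p))
    ; down⇒up    = λ p → cong transpose (left⇒right (untranspose p))
    }
  ; ¬right² = λ p q → ¬up² (untranspose p) (untranspose q)
  ; ¬up²    = λ p q → ¬right² (untranspose p) (untranspose q)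
  }
  where open FlipFree φ

antitransposed-flipFree : ∀ {f} → FlipFree f → FlipFree (antitransposed f)
antitransposed-flipFree φ =
  mirrored-flipFree (transposed-flipFree (mirrored-flipFree φ))

-- The directions at the four tips of a windmill tiling centred at the origin.
Core₁ Core₂ : Field → Set
Core₁ f = f -1ℤ 0ℤ ≡ up × f 0ℤ 0ℤ ≡ right × f 0ℤ -1ℤ ≡ down × f -1ℤ -1ℤ ≡ left
Core₂ f = f 0ℤ 0ℤ ≡ up × f 0ℤ -1ℤ ≡ right × f -1ℤ -1ℤ ≡ down × f -1ℤ 0ℤ ≡ left

HasCore : Field → Set
HasCore f = ∃₂ λ a b → Core₁ (shift a b f) ⊎ Core₂ (shift a b f)

_≗₂_ : Field → Field → Set
f ≗₂ g = ∀ x y → f x y ≡ g x y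

core₁-cong : ∀ {f g} → f ≗₂ g → Core₁ f → Core₁ g
core₁-cong e (n , r , s , l) = trans (sym (e _ _)) n , trans (sym (e _ _)) r ,
  trans (sym (e _ _)) s , trans (sym (e _ _)) l

core₂-cong : ∀ {f g} → f ≗₂ g → Core₂ f → Core₂ g
core₂-cong e (n , r , s , l) = trans (sym (e _ _)) n , trans (sym (e _ _)) r ,
  trans (sym (e _ _)) s , trans (sym (e _ _)) l

shift-hasCore : ∀ x y f → HasCore (shift x y f) → HasCore f
shift-hasCore x y f (a , b , c) = x + a , y + b ,
  Sum.map (core₁-cong e) (core₂-cong e) c
  where
  e : shift a b (shift x y f) ≗₂ shift (x + a) (y + b) f
  e u v = cong₂ f (+-assocʳ x a u) (+-assocʳ y b v)

-- A reflection reverses the sense of rotation of a core, so `Core₁` and `Core₂` change places.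
transposed-hasCore : ∀ f → HasCore (transposed f) → HasCore f
transposed-hasCore f (a , b , c) = b , a , swap c
  where
  e : transposed (shift a b (transposed f)) ≗₂ shift b a f
  e u v = transpose-involutive _
  swap : Core₁ (shift a b (transposed f)) ⊎ Core₂ (shift a b (transposed f)) →
         Core₁ (shift b a f) ⊎ Core₂ (shift b a f)
  swap (inj₁ (n , r , s , l)) = inj₂ (core₂-cong e
    (cong transpose r , cong transpose n , cong transpose l , cong transpose s))
  swap (inj₂ (n , r , s , l)) = inj₁ (core₁-cong e
    (cong transpose r , cong transpose n , cong transpose l , cong transpose s))

-- A core occupies the columns -1 and 0, which are exchanged by `u ↦ -1 - u` and not by the negation
-- in `mirrored`. The difference moves the centre to `1ℤ - a`.
mirrored-hasCore : ∀ f → HasCore (mirrored f) → HasCore f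
mirrored-hasCore f (a , b , c) = 1ℤ - a , b , swap c
  where
  g : Field
  g = shift a b (mirrored f)
  flip : ∀ a u → - (a + (-1ℤ + - u)) ≡ 1ℤ - a + u
  flip = solve-∀
  e : (λ u v → mirror (g (-1ℤ + - u) v)) ≗₂ shift (1ℤ - a) b f
  e u v = trans (mirror-involutive _) (cong (λ z → f z (b + v)) (flip a u))
  swap : Core₁ g ⊎ Core₂ g → Core₁ (shift (1ℤ - a) b f) ⊎ Core₂ (shift (1ℤ - a) b f)
  swap (inj₁ (n , r , s , l)) = inj₂ (core₂-cong e
    (cong mirror n , cong mirror l , cong mirror s , cong mirror r))
  swap (inj₂ (n , r , s , l)) = inj₁ (core₁-cong e
    (cong mirror n , cong mirror l , cong mirror s , cong mirror r))

antitransposed-hasCore : ∀ f → HasCore (antitransposed f) → HasCore f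
antitransposed-hasCore f c = mirrored-hasCore f
  (transposed-hasCore (mirrored f) (mirrored-hasCore (transposed (mirrored f)) c))

-- Edges and their propagation along a diagonal

-- The vertical domino at (x , y) whose translate by (1,-1) is missing.
Edge : Field → ℤ → ℤ → Set
Edge f x y = f x y ≡ up × f (suc x) y ≡ right

HasEdge : Field → Set
HasEdge f = ∃₂ (Edge f)

module AtOrigin {f : Field} (φ : FlipFree f) where
  open FlipFree φ

  -- The square (1,1) lies above the horizontal domino and to the right of the upper half of the
  -- vertical one. `down` and `left` run into these dominoes, and `right` completes a flip. The
  -- square (2,1) is then forced in the same way.
  edge-step₀ : Edge f 0ℤ 0ℤ → Edge f 1ℤ 1ℤ
  edge-step₀ (u , r) = u′ , r′
    where
    u′ : f 1ℤ 1ℤ ≡ up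
    u′ = is-up (λ e → clash (down⇒up e) r λ ())
               (λ e → clash (left⇒right e) (up⇒down u) λ ())
               (¬right² r)
    r′ : f (+ 2) 1ℤ ≡ right
    r′ = is-right (¬up² u′)
                  (λ e → clash (down⇒up e) (right⇒left r) λ ())
                  (λ e → clash (left⇒right e) u′ λ ())

  -- The square (0,-1) decides. `up` runs into the vertical domino, and `down` leaves no direction
  -- for (1,-1). `left` closes a core around the point (1,0). With `right`, the square (-1,0) either
  -- continues the edge backwards (`down`) or closes the opposite core around the origin (`left`).
  edge-back₀ : Edge f 0ℤ 0ℤ →
    Edge f -1ℤ -1ℤ ⊎ Core₁ (shift 1ℤ 0ℤ f) ⊎ Core₂ f
  edge-back₀ (u , r) with f 0ℤ -1ℤ in below
  ... | up = ⊥-elim (clash (up⇒down below) u λ ())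
  ... | left = inj₂ (inj₁ (u , r , s , refl))
    where
    s : f 1ℤ -1ℤ ≡ down
    s = is-down (λ e → clash (up⇒down e) r λ ())
                (λ e → clash (left⇒right e) below λ ())
                (λ e → ¬right² e r)
  ... | down with f 1ℤ -1ℤ in e
  ...   | up    = ⊥-elim (clash (up⇒down e) r λ ())
  ...   | down  = ⊥-elim (¬up² (down⇒up below) (down⇒up e))
  ...   | left  = ⊥-elim (clash (left⇒right e) below λ ())
  ...   | right = ⊥-elim (¬right² e r)
  edge-back₀ (u , r) | right with f -1ℤ 0ℤ in e
  ...   | up    = ⊥-elim (¬up² e u)
  ...   | right = ⊥-elim (clash (right⇒left e) u λ ())
  ...   | down  = inj₁ (down⇒up e , refl)
  ...   | left  = inj₂ (inj₂ (u , refl , s , refl))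
    where
    s : f -1ℤ -1ℤ ≡ down
    s = is-down (λ d → clash (up⇒down d) e λ ())
                (λ d → ¬right² (left⇒right d) (left⇒right e))
                (λ d → clash (right⇒left d) below λ ())

module _ {f : Field} (φ : FlipFree f) where
  open FlipFree φ

  edge⇒origin : ∀ {x y} → Edge f x y → Edge (shift x y f) 0ℤ 0ℤ
  edge⇒origin {x} {y} (u , r) =
    at f (p x) (p y) u , at f (q x) (p y) r
    where
    p : ∀ x → x ≡ x + 0ℤ
    p = solve-∀
    q : ∀ x → 1ℤ + x ≡ x + 1ℤ
    q = solve-∀

  origin⇒edge : ∀ x y a b → Edge (shift x y f) a b → Edge f (x + a) (y + b)
  origin⇒edge x _ a _ (u , r) = u , at f (+-sucʳ x a) refl r

  edge-step : ∀ {x y} → Edge f x y → Edge f (x + 1ℤ) (y + 1ℤ)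
  edge-step {x} {y} e =
    origin⇒edge x y _ _ (AtOrigin.edge-step₀ (shift-flipFree x y φ) (edge⇒origin e))

  edge-back : ¬ HasCore f → ∀ {x y} → Edge f x y → Edge f (x + -1ℤ) (y + -1ℤ)
  edge-back ¬core {x} {y} e
    with AtOrigin.edge-back₀ (shift-flipFree x y φ) (edge⇒origin e)
  ... | inj₁ e′ = origin⇒edge x y _ _ e′
  ... | inj₂ (inj₁ c) = contradiction (shift-hasCore x y f (1ℤ , 0ℤ , inj₁ c)) ¬core
  ... | inj₂ (inj₂ c) = contradiction (shift-hasCore x y f (0ℤ , 0ℤ , inj₂ c)) ¬core

-- Bi-infinite lines of edges and the bands they fill

ℤ-induction : (P : ℤ → Set) → P 0ℤ → (∀ k → P k → P (suc k)) →
  (∀ k → P k → P (pred k)) → ∀ k → P k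
ℤ-induction P z s p (+ ℕ.zero)      = z
ℤ-induction P z s p (+ ℕ.suc n)     = s (+ n) (ℤ-induction P z s p (+ n))
ℤ-induction P z s p -[1+ ℕ.zero ]   = p 0ℤ z
ℤ-induction P z s p -[1+ ℕ.suc n ]  = p -[1+ n ] (ℤ-induction P z s p -[1+ n ])

edge-line : ∀ {f} → FlipFree f → ¬ HasCore f → ∀ {x y} → Edge f x y →
  ∀ k → Edge f (x + k) (y + k)
edge-line {f} φ ¬core {x} {y} e = ℤ-induction (λ k → Edge f (x + k) (y + k))
  (move (λ x → x + 0ℤ) (zeroʳ x) (zeroʳ y) e)
  (λ k e → move (λ x → x + (1ℤ + k)) (next x k) (next y k) (edge-step φ e))
  (λ k e → move (λ x → x + (-1ℤ + k)) (prev x k) (prev y k) (edge-back φ ¬core e))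
  where
  move : ∀ (g : ℤ → ℤ) {a b} → a ≡ g x → b ≡ g y → Edge f a b → Edge f (g x) (g y)
  move _ refl refl e = e
  zeroʳ : ∀ x → x ≡ x + 0ℤ
  zeroʳ = solve-∀
  next : ∀ x k → x + k + 1ℤ ≡ x + (1ℤ + k)
  next = solve-∀
  prev : ∀ x k → x + k + -1ℤ ≡ x + (-1ℤ + k)
  prev = solve-∀

-- Two consecutive diagonals are taken because an antidiagonal has squares on diagonals of one
-- parity only; a band of width two is met by every antidiagonal.
Band : (Direction → Set) → Field → Set
Band P f = ∃[ u ] (∀ x y → x - y ≡ u ⊎ x - y ≡ suc u → P (f x y))

x≡v+y : ∀ {x y v} → x - y ≡ v → x ≡ v + y
x≡v+y {x} {y} refl = lemma x y
  where
  lemma : ∀ x y → x ≡ x - y + y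
  lemma = solve-∀

-- Along the line the `up` squares fill the diagonal `a - b` and their partners `pred (a - b)`; the
-- `right` squares fill `suc (a - b)` and their partners the diagonal after it.
edge⇒bands : ∀ {f} → FlipFree f → ¬ HasCore f → HasEdge f →
  Band IsVertical f × Band IsHorizontal f
edge⇒bands {f} φ ¬core (a , b , e) = (pred (a - b) , verticals) , (suc (a - b) , horizontals)
  where
  open FlipFree φ
  line : ∀ k → Edge f (a + k) (b + k)
  line = edge-line φ ¬core e
  level : ∀ b y → b + (y - b) ≡ y
  level = solve-∀
  level⁻ : ∀ b y → 1ℤ + (b + (y - b - 1ℤ)) ≡ y
  level⁻ = solve-∀
  ups : ∀ a b y → a + (y - b) ≡ a - b + y
  ups = solve-∀
  downs : ∀ a b y → a + (y - b - 1ℤ) ≡ -1ℤ + (a - b) + y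
  downs = solve-∀
  rights : ∀ a b y → 1ℤ + (a + (y - b)) ≡ 1ℤ + (a - b) + y
  rights = solve-∀
  lefts : ∀ a b y → 1ℤ + (1ℤ + (a + (y - b))) ≡ 1ℤ + (1ℤ + (a - b)) + y
  lefts = solve-∀
  verticals : ∀ x y → x - y ≡ pred (a - b) ⊎ x - y ≡ suc (pred (a - b)) →
    IsVertical (f x y)
  verticals x y (inj₁ p) = inj₂ (at f (trans (downs a b y) (sym (x≡v+y p))) (level⁻ b y)
    (up⇒down (proj₁ (line (y - b - 1ℤ)))))
  verticals x y (inj₂ p) = inj₁ (at f
    (trans (ups a b y) (sym (x≡v+y (trans p (suc-pred (a - b)))))) (level b y)
    (proj₁ (line (y - b))))
  horizontals : ∀ x y → x - y ≡ suc (a - b) ⊎ x - y ≡ suc (suc (a - b)) →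
    IsHorizontal (f x y)
  horizontals x y (inj₁ p) = inj₁ (at f (trans (rights a b y) (sym (x≡v+y p))) (level b y)
    (proj₂ (line (y - b))))
  horizontals x y (inj₂ p) = inj₂ (at f (trans (lefts a b y) (sym (x≡v+y p))) (level b y)
    (right⇒left (proj₂ (line (y - b)))))

antitransposed-band : ∀ {P Q f} → (∀ d → P (mirror (transpose (mirror d))) → Q d) →
  Band P (antitransposed f) → Band Q f
antitransposed-band {P} {f = f} P⇒Q (u , band) = u , λ x y p →
  P⇒Q (f x y) (subst P
    (cong₂ (λ x y → mirror (transpose (mirror (f x y)))) (neg-involutive x) (neg-involutive y))
    (band (- y) (- x) (Sum.map (trans (swap x y)) (trans (swap x y)) p)))
  where
  swap : ∀ x y → - y - - x ≡ x - y
  swap = solve-∀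

antitransposed-vertical : ∀ d → IsVertical (mirror (transpose (mirror d))) → IsHorizontal d
antitransposed-vertical right _ = inj₁ refl
antitransposed-vertical left  _ = inj₂ refl
antitransposed-vertical up   (inj₁ ())
antitransposed-vertical up   (inj₂ ())
antitransposed-vertical down (inj₁ ())
antitransposed-vertical down (inj₂ ())

antitransposed-horizontal : ∀ d → IsHorizontal (mirror (transpose (mirror d))) → IsVertical d
antitransposed-horizontal up   _ = inj₁ refl
antitransposed-horizontal down _ = inj₂ refl
antitransposed-horizontal right (inj₁ ())
antitransposed-horizontal right (inj₂ ())
antitransposed-horizontal left  (inj₁ ())
antitransposed-horizontal left  (inj₂ ())

even⊎odd : ∀ n → ∃[ k ] (n ≡ k + k ⊎ n ≡ suc (k + k))
even⊎odd = ℤ-induction _ (0ℤ , inj₁ refl)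
  (λ { n (k , inj₁ refl) → k , inj₂ refl
     ; n (k , inj₂ refl) → suc k , inj₁ (next k) })
  (λ { n (k , inj₁ refl) → pred k , inj₂ (prev k)
     ; n (k , inj₂ refl) → k , inj₁ (pred-suc _) })
  where
  next : ∀ k → 1ℤ + (1ℤ + (k + k)) ≡ 1ℤ + k + (1ℤ + k)
  next = solve-∀
  prev : ∀ k → -1ℤ + (k + k) ≡ 1ℤ + (-1ℤ + k + (-1ℤ + k))
  prev = solve-∀

-- The square (- v - y , y) lies on the antidiagonal x + y = - v, and only every
-- other diagonal meets that antidiagonal in a square.
diagonals-meet : ∀ u v → ∃[ y ] (- v - y - y ≡ u ⊎ - v - y - y ≡ suc u)
diagonals-meet u v with even⊎odd (u + v)
... | k , inj₁ p = - k ,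
  inj₁ (trans (lemma u v k) (trans (cong (λ z → u - z + (k + k)) p) (cancel u k)))
  where
  lemma : ∀ u v k → - v - - k - - k ≡ u - (u + v) + (k + k)
  lemma = solve-∀
  cancel : ∀ u k → u - (k + k) + (k + k) ≡ u
  cancel = solve-∀
... | k , inj₂ p = - suc k ,
  inj₂ (trans (lemma u v k) (trans (cong (λ z → u - z + (1ℤ + (1ℤ + (k + k)))) p) (cancel u k)))
  where
  lemma : ∀ u v k → - v - - (1ℤ + k) - - (1ℤ + k) ≡ u - (u + v) + (1ℤ + (1ℤ + (k + k)))
  lemma = solve-∀
  cancel : ∀ u k → u - (1ℤ + (k + k)) + (1ℤ + (1ℤ + (k + k))) ≡ 1ℤ + u
  cancel = solve-∀

mirror-vertical : ∀ d → IsVertical (mirror d) → IsVertical d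
mirror-vertical up   _ = inj₁ refl
mirror-vertical down _ = inj₂ refl
mirror-vertical left  (inj₁ ())
mirror-vertical left  (inj₂ ())
mirror-vertical right (inj₁ ())
mirror-vertical right (inj₂ ())

-- Seen in `f`, the second band runs along antidiagonals, and mirroring keeps vertical squares
-- vertical. A square common to both bands would be horizontal and vertical at once.
¬crossing-bands : ∀ {f} → Band IsHorizontal f → ¬ Band IsVertical (mirrored f)
¬crossing-bands {f} (u , horizontals) (v , verticals) with diagonals-meet u v
... | y , p = ¬horizontal×vertical (horizontals x y p) (mirror-vertical (f x y)
    (subst (λ z → IsVertical (mirror (f z y))) (neg-involutive x)
      (verticals (- x) y (inj₁ (lemma v y)))))
  where
  x : ℤ
  x = - v - y
  lemma : ∀ v y → - (- v - y) - y ≡ v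
  lemma = solve-∀

-- Defects and the trichotomy for flip-free fields

Defect : Field → Set
Defect f = HasEdge f ⊎ HasEdge (antitransposed f)

-- An edge of `antitransposed f` is a horizontal domino of `f` whose translate by (1,-1) is missing.
-- Since the reflection keeps diagonals and exchanges orientations, either kind of defect produces a
-- band of each orientation.
defect⇒bands : ∀ {f} → FlipFree f → ¬ HasCore f → Defect f →
  Band IsVertical f × Band IsHorizontal f
defect⇒bands φ ¬core (inj₁ e) = edge⇒bands φ ¬core e
defect⇒bands {f} φ ¬core (inj₂ e)
  with edge⇒bands (antitransposed-flipFree φ) (λ c → ¬core (antitransposed-hasCore f c)) e
... | v , h = antitransposed-band {P = IsHorizontal} antitransposed-horizontal h ,
              antitransposed-band {P = IsVertical} antitransposed-vertical v

Falling Rising : Field → Set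
Falling f = ∀ x y → f (suc x) (pred y) ≡ f x y
Rising  f = ∀ x y → f (suc x) (suc y) ≡ f x y

-- The matching, the absence of flips and the absence of defects leave one direction beside an `up`
-- square and one below a `left` square. Passing to the partner before or after such a move gives
-- the step (1,-1) from any square.
¬defect⇒falling : ∀ {f} → FlipFree f → ¬ Defect f → Falling f
¬defect⇒falling {f} φ ¬defect x y = go (f x y) refl
  where
  open FlipFree φ
  beside-up : ∀ {x y} → f x y ≡ up → f (suc x) y ≡ down
  beside-up {x} {y} e = is-down (¬up² e)
    (λ l → clash (at f (pred-suc x) refl (left⇒right l)) e λ ())
    (λ r → ¬defect (inj₁ (x , y , e , r)))
  pred-neg : ∀ y → -1ℤ + y ≡ - (1ℤ + - y)
  pred-neg = solve-∀
  below-left : ∀ {x y} → f x y ≡ left → f x (pred y) ≡ right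
  below-left {x} {y} e = is-right
    (λ u → clash (at f refl (suc-pred y) (up⇒down u)) e λ ())
    -- The `left` square above a `down` square is read as an edge at the reflected square.
    (λ d → ¬defect (inj₂ (- y , - x ,
      cong (λ d → mirror (transpose (mirror d)))
        (at f (sym (neg-involutive x)) (sym (neg-involutive y)) e) ,
      cong (λ d → mirror (transpose (mirror d)))
        (at f (sym (neg-involutive x)) (pred-neg y) d))))
    (λ l → ¬right² (left⇒right l) (at f refl (sym (suc-pred y)) (left⇒right e)))
  go : ∀ d → f x y ≡ d → f (suc x) (pred y) ≡ f x y
  go up    e = trans (down⇒up (beside-up e)) (sym e)
  go down  e = trans (beside-up (down⇒up e)) (sym e)
  go left  e = trans (right⇒left (below-left e)) (sym e)
  go right e = trans (below-left (right⇒left e)) (sym e)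

falling⇒rising : ∀ {f} → Falling (mirrored f) → Rising f
falling⇒rising {f} inv x y = trans (sym (mirror-involutive _))
  (trans (cong mirror eq) (mirror-involutive _))
  where
  shifted : ∀ x → - (1ℤ + (- (1ℤ + x))) ≡ x
  shifted = solve-∀
  eq : mirror (f (suc x) (suc y)) ≡ mirror (f x y)
  eq = trans (cong₂ (λ x y → mirror (f x y)) (sym (neg-involutive (suc x))) refl)
      (trans (sym (inv (- suc x) (suc y)))
        (cong₂ (λ x y → mirror (f x y)) (shifted x) (pred-suc y)))

flipFree⇒core⊎falling⊎rising : ExcludedMiddle 0ℓ → ∀ {f} → FlipFree f →
  HasCore f ⊎ Falling f ⊎ Rising f
flipFree⇒core⊎falling⊎rising em {f} φ with em {P = HasCore f}
... | yes core = inj₁ core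
... | no ¬core with em {P = Defect f} | em {P = Defect (mirrored f)}
...   | no ¬d  | _      = inj₂ (inj₁ (¬defect⇒falling φ ¬d))
...   | yes _  | no ¬d  =
  inj₂ (inj₂ (falling⇒rising (¬defect⇒falling (mirrored-flipFree φ) ¬d)))
...   | yes d  | yes d′ = contradiction
  (proj₁ (defect⇒bands (mirrored-flipFree φ) (λ c → ¬core (mirrored-hasCore f c)) d′))
  (¬crossing-bands (proj₂ (defect⇒bands φ ¬core d)))

-- Forcing a quadrant from its tip

Tip : Field → Set
Tip f = f 0ℤ 0ℤ ≡ up × f 1ℤ 0ℤ ≡ right × f -1ℤ 0ℤ ≡ left

module _ {f : Field} (φ : FlipFree f) where
  open FlipFree φ

  -- A core gives the square on one side of the tip and the square behind it. The partner of the
  -- latter lies below the unknown neighbour and excludes `down` there. Which side is given depends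
  -- on the sense of rotation, hence two versions.
  tip-above-left : f 0ℤ 0ℤ ≡ up → f 1ℤ 0ℤ ≡ right → f 0ℤ -1ℤ ≡ left → Tip f
  tip-above-left u r l = u , r ,
    is-left (λ u′ → ¬up² u′ u)
            (λ d → clash (down⇒up d) (left⇒right l) λ ())
            (λ r′ → clash (right⇒left r′) u λ ())

  tip-above-right : f 0ℤ 0ℤ ≡ up → f -1ℤ 0ℤ ≡ left → f 0ℤ -1ℤ ≡ right → Tip f
  tip-above-right u l r = u ,
    is-right (¬up² u)
             (λ d → clash (down⇒up d) (right⇒left r) λ ())
             (λ l′ → clash (left⇒right l′) u λ ()) ,
    l

  edge-ray : Edge f 0ℤ 0ℤ → ∀ n → Edge f (+ n) (+ n)
  edge-ray e ℕ.zero    = e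
  edge-ray e (ℕ.suc n) =
    at f (+-comm (+ n) 1ℤ) (+-comm (+ n) 1ℤ) (proj₁ e′) ,
    at f (cong suc (+-comm (+ n) 1ℤ)) (+-comm (+ n) 1ℤ) (proj₂ e′)
    where
    e′ : Edge f (+ n + 1ℤ) (+ n + 1ℤ)
    e′ = edge-step φ (edge-ray e n)

  -- The square in question rests on the domino at `(x , y)` and has upper halves of vertical
  -- dominoes on both sides, so only `up` is free.
  between-ups : ∀ {x y} → f x y ≡ up → f (suc x) (suc y) ≡ up → f (pred x) (suc y) ≡ up →
    f x (suc (suc y)) ≡ up
  between-ups {x} {y} u u⁺ u⁻ = is-up
    (λ d → clash (at f refl (pred-suc (suc y)) (down⇒up d)) (up⇒down u) λ ())
    (λ l → clash (left⇒right l) (up⇒down u⁻) λ ())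
    (λ r → clash (right⇒left r) (up⇒down u⁺) λ ())

suc-neg-suc : ∀ n → suc -[1+ n ] ≡ - + n
suc-neg-suc n = trans (cong suc (neg-suc n)) (suc-pred (- + n))

module _ {f : Field} (φ : FlipFree f) (tip : Tip f) where

  tip-right : ∀ n → f (+ n) (+ n) ≡ up
  tip-right n = proj₁ (edge-ray φ (proj₁ tip , proj₁ (proj₂ tip)) n)

  tip-left : ∀ n → f (- + n) (+ n) ≡ up
  tip-left n = unmirror (proj₁ (edge-ray (mirrored-flipFree φ)
    (cong mirror (proj₁ tip) , cong mirror (proj₂ (proj₂ tip))) n))

  -- Layer 0 consists of the two rays of edges issuing from the tip, one on each side. In layer
  -- `suc k` a domino rests on layer `k`; its outer neighbour belongs to layer `k` and its inner one
  -- to layer `suc k`, so the induction runs over layers and then outwards. In the middle column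
  -- both neighbours are outer. The order `k * 2` makes `suc k * 2` unfold to two successors.
  tip-ups : ∀ k n → f (+ n) (+ (k ℕ.* 2 ℕ.+ n)) ≡ up × f (- + n) (+ (k ℕ.* 2 ℕ.+ n)) ≡ up
  tip-ups ℕ.zero    n         = tip-right n , tip-left n
  tip-ups (ℕ.suc k) ℕ.zero    = u , u
    where
    r : f 1ℤ (suc (+ (k ℕ.* 2 ℕ.+ 0))) ≡ up
    r = at f refl (cong +_ (ℕ.+-suc (k ℕ.* 2) 0)) (proj₁ (tip-ups k 1))
    l : f -1ℤ (suc (+ (k ℕ.* 2 ℕ.+ 0))) ≡ up
    l = at f refl (cong +_ (ℕ.+-suc (k ℕ.* 2) 0)) (proj₂ (tip-ups k 1))
    u : f 0ℤ (+ (ℕ.suc k ℕ.* 2 ℕ.+ 0)) ≡ up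
    u = between-ups φ (proj₁ (tip-ups k 0)) r l
  tip-ups (ℕ.suc k) (ℕ.suc n) =
    between-ups φ (proj₁ (tip-ups k (ℕ.suc n)))
      (at f refl outer (proj₁ (tip-ups k (ℕ.suc (ℕ.suc n)))))
      (at f (sym (pred-suc (+ n))) inner (proj₁ (tip-ups (ℕ.suc k) n))) ,
    between-ups φ (proj₂ (tip-ups k (ℕ.suc n)))
      (at f (sym (suc-neg-suc n)) inner (proj₂ (tip-ups (ℕ.suc k) n)))
      (at f refl outer (proj₂ (tip-ups k (ℕ.suc (ℕ.suc n)))))
    where
    outer : + (k ℕ.* 2 ℕ.+ ℕ.suc (ℕ.suc n)) ≡ suc (+ (k ℕ.* 2 ℕ.+ ℕ.suc n))
    outer = cong +_ (ℕ.+-suc (k ℕ.* 2) (ℕ.suc n))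
    inner : + (ℕ.suc k ℕ.* 2 ℕ.+ n) ≡ suc (+ (k ℕ.* 2 ℕ.+ ℕ.suc n))
    inner = cong (λ m → + ℕ.suc m) (sym (ℕ.+-suc (k ℕ.* 2) n))

  tip-fill : ∀ i k → f i (+ ∣ i ∣ + + 2 * + k) ≡ up
  tip-fill i k = at f refl height (column i)
    where
    column : ∀ i → f i (+ (k ℕ.* 2 ℕ.+ ∣ i ∣)) ≡ up
    column (+ n)    = proj₁ (tip-ups k n)
    column -[1+ n ] = proj₂ (tip-ups k (ℕ.suc n))
    reorder : ∀ k n → k * + 2 + n ≡ n + + 2 * k
    reorder = solve-∀
    height : + (k ℕ.* 2 ℕ.+ ∣ i ∣) ≡ + ∣ i ∣ + + 2 * + k
    height = trans (cong (_+ + ∣ i ∣) (pos-* k 2)) (reorder (+ k) (+ ∣ i ∣))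

-- Dominoes as directed squares

vertical≡ : ∀ {x x′ y y′} → x ≡ x′ → y ≡ y′ →
  domino vertical (x , y) ≡ domino vertical (x′ , y′)
vertical≡ refl refl = refl

horizontal≡ : ∀ {x x′ y y′} → x ≡ x′ → y ≡ y′ →
  domino horizontal (x , y) ≡ domino horizontal (x′ , y′)
horizontal≡ refl refl = refl

dominoAt : Direction → ℤ → ℤ → Domino
dominoAt up    x y = domino vertical (x , y)
dominoAt down  x y = domino vertical (x , pred y)
dominoAt right x y = domino horizontal (x , y)
dominoAt left  x y = domino horizontal (pred x , y)

pred[x+1] : ∀ x → -1ℤ + (x + 1ℤ) ≡ x
pred[x+1] = solve-∀

x+0 : ∀ x → x + 0ℤ ≡ x
x+0 = solve-∀

pred[x]+1 : ∀ x → -1ℤ + x + 1ℤ ≡ x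
pred[x]+1 = solve-∀

dominoAt-covers : ∀ d x y → (x , y) ∈ squares (dominoAt d x y)
dominoAt-covers up    x y = inj₁ refl
dominoAt-covers down  x y = inj₂ (cong₂ _,_ (x+0 x) (pred[x]+1 y))
dominoAt-covers right x y = inj₁ refl
dominoAt-covers left  x y = inj₂ (cong₂ _,_ (pred[x]+1 x) (x+0 y))

covered⇒dominoAt : ∀ D {x y} → (x , y) ∈ squares D → ∃[ d ] D ≡ dominoAt d x y
covered⇒dominoAt (domino horizontal c) (inj₁ refl) = right , refl
covered⇒dominoAt (domino horizontal (a , b)) (inj₂ refl) = left ,
  horizontal≡ (sym (pred[x+1] a)) (sym (x+0 b))
covered⇒dominoAt (domino vertical c) (inj₁ refl) = up , refl
covered⇒dominoAt (domino vertical (a , b)) (inj₂ refl) = down ,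
  vertical≡ (sym (x+0 a)) (sym (pred[x+1] b))

pred≢ : ∀ x → pred x ≢ x
pred≢ x p = i≢suc[i] (trans p (sym (suc-pred x)))

dominoAt-injective : ∀ d e {x y} → dominoAt d x y ≡ dominoAt e x y → d ≡ e
dominoAt-injective up    up    _ = refl
dominoAt-injective up    down  p = contradiction (sym (cong (proj₂ ∘ corner) p)) (pred≢ _)
dominoAt-injective up    left  ()
dominoAt-injective up    right ()
dominoAt-injective down  up    p = contradiction (cong (proj₂ ∘ corner) p) (pred≢ _)
dominoAt-injective down  down  _ = refl
dominoAt-injective down  left  ()
dominoAt-injective down  right ()
dominoAt-injective left  up    ()
dominoAt-injective left  down  ()
dominoAt-injective left  left  _ = refl
dominoAt-injective left  right p = contradiction (cong (proj₁ ∘ corner) p) (pred≢ _)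
dominoAt-injective right up    ()
dominoAt-injective right down  ()
dominoAt-injective right left  p = contradiction (sym (cong (proj₁ ∘ corner) p)) (pred≢ _)
dominoAt-injective right right _ = refl

translate-dominoAt : ∀ d x y u v → translate (u , v) (dominoAt d x y) ≡ dominoAt d (x + u) (y + v)
translate-dominoAt up    x y u v = refl
translate-dominoAt down  x y u v = cong (λ z → domino vertical (x + u , z)) (+-assoc -1ℤ y v)
translate-dominoAt right x y u v = refl
translate-dominoAt left  x y u v = cong (λ z → domino horizontal (z , y + v)) (+-assoc -1ℤ x u)

-- Invariance and staggering

Invariant : Slope → Field → Set
Invariant s f = ∀ x y → f (x + proj₁ (step s)) (y + proj₂ (step s)) ≡ f x y

x+m≢x : ∀ {x m} → m ≢ 0ℤ → x + m ≢ x
x+m≢x {x} {m} m≢0 p = m≢0 (trans (lemma x m) (trans (cong (_- x) p) (+-inverseʳ x)))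
  where
  lemma : ∀ x m → m ≡ x + m - x
  lemma = solve-∀

-- The signs are chosen for the lower or left domino of a flip: `aside`, like (1,1), moves it partly
-- onto the other domino.
aside : Orientation → Point
aside horizontal = (-1ℤ , 1ℤ)
aside vertical   = (1ℤ , -1ℤ)

-- Windmills and unions of parallel staircases have this property, and it
-- excludes flips: one of the two translates overlaps the other domino of a flip.
Staggered : Pred Domino 0ℓ → Set
Staggered P = ∀ D → D ∈ P → translate (1ℤ , 1ℤ) D ∈ P ⊎ translate (aside (orientation D)) D ∈ P

∪-staggered : ∀ P Q → Staggered P → Staggered Q → Staggered (P ∪ Q)
∪-staggered _ _ p q D (inj₁ d) = Sum.map inj₁ inj₁ (p D d)
∪-staggered _ _ p q D (inj₂ d) = Sum.map inj₂ inj₂ (q D d)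

-- Quadrants and windmills: coverage and staggering

∣suc-neg-suc∣ : ∀ n → ∣ suc -[1+ n ] ∣ ≡ n
∣suc-neg-suc∣ n = trans (cong ∣_∣ (suc-neg-suc n)) (∣-i∣≡∣i∣ (+ n))

even⊎oddℕ : ∀ m → ∃[ k ] (+ m ≡ + 2 * + k ⊎ + m ≡ 1ℤ + + 2 * + k)
even⊎oddℕ ℕ.zero = 0 , inj₁ refl
even⊎oddℕ (ℕ.suc m) with even⊎oddℕ m
... | k , inj₁ p = k , inj₂ (cong suc p)
... | k , inj₂ p = ℕ.suc k , inj₁ (trans (cong suc p) (lemma (+ k)))
  where
  lemma : ∀ k → 1ℤ + (1ℤ + + 2 * k) ≡ + 2 * (1ℤ + k)
  lemma = solve-∀

Covers : Pred Domino 0ℓ → ℤ → ℤ → Set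
Covers P x y = ∃[ d ] dominoAt d x y ∈ P

even-offset : ∀ {m} k b n → m ≡ + 2 * + k → b + (n + m) ≡ b + n + + 2 * + k
even-offset k b n refl = lemma b n (+ k)
  where
  lemma : ∀ b n k → b + (n + + 2 * k) ≡ b + n + + 2 * k
  lemma = solve-∀

odd-offset : ∀ {m} k b n → m ≡ 1ℤ + + 2 * + k → pred (b + (n + m)) ≡ b + n + + 2 * + k
odd-offset k b n refl = lemma b n (+ k)
  where
  lemma : ∀ b n k → -1ℤ + (b + (n + (1ℤ + + 2 * k))) ≡ b + n + + 2 * k
  lemma = solve-∀

even-offset⁻ : ∀ {m} k b n → m ≡ + 2 * + k →
  pred (b - (n + m)) ≡ + 2 * b - 1ℤ - (b + n + + 2 * + k)
even-offset⁻ k b n refl = lemma b n (+ k)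
  where
  lemma : ∀ b n k → -1ℤ + (b - (n + + 2 * k)) ≡ + 2 * b - 1ℤ - (b + n + + 2 * k)
  lemma = solve-∀

odd-offset⁻ : ∀ {m} k b n → m ≡ 1ℤ + + 2 * + k →
  b - (n + m) ≡ + 2 * b - 1ℤ - (b + n + + 2 * + k)
odd-offset⁻ k b n refl = lemma b n (+ k)
  where
  lemma : ∀ b n k → b - (n + (1ℤ + + 2 * k)) ≡ + 2 * b - 1ℤ - (b + n + + 2 * k)
  lemma = solve-∀

module _ (a b : ℤ) where

  -- The number `m` counts squares from the bottom of the column: even `m` gives the lower half of a
  -- domino, odd `m` the upper half.
  north-covers : ∀ {x y} i m → x ≡ a + i → y ≡ b + (+ ∣ i ∣ + + m) → Covers (north (a , b)) x y
  north-covers i m refl refl with even⊎oddℕ m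
  ... | k , inj₁ p = up   , i , k , vertical≡ refl (even-offset k b (+ ∣ i ∣) p)
  ... | k , inj₂ p = down , i , k , vertical≡ refl (odd-offset k b (+ ∣ i ∣) p)

  east-covers : ∀ {x y} j m → y ≡ b + j → x ≡ a + (+ ∣ j ∣ + + m) → Covers (east (a , b)) x y
  east-covers j m refl refl with even⊎oddℕ m
  ... | k , inj₁ p = right , j , k , horizontal≡ (even-offset k a (+ ∣ j ∣) p) refl
  ... | k , inj₂ p = left  , j , k , horizontal≡ (odd-offset k a (+ ∣ j ∣) p) refl

  -- The reflection exchanges the two halves, so even `m` now gives `down`.
  south-covers : ∀ {x y} i m → x ≡ a + i → y ≡ b - (+ ∣ i ∣ + + m) → Covers (south (a , b)) x y
  south-covers i m refl refl with even⊎oddℕ m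
  ... | k , inj₁ p = down , _ , (i , k , refl) , vertical≡ refl (even-offset⁻ k b (+ ∣ i ∣) p)
  ... | k , inj₂ p = up   , _ , (i , k , refl) , vertical≡ refl (odd-offset⁻ k b (+ ∣ i ∣) p)

  west-covers : ∀ {x y} j m → y ≡ b + j → x ≡ a - (+ ∣ j ∣ + + m) → Covers (west (a , b)) x y
  west-covers j m refl refl with even⊎oddℕ m
  ... | k , inj₁ p = left  , _ , (j , k , refl) , horizontal≡ (even-offset⁻ k a (+ ∣ j ∣) p) refl
  ... | k , inj₂ p = right , _ , (j , k , refl) , horizontal≡ (odd-offset⁻ k a (+ ∣ j ∣) p) refl

  private
    assoc : ∀ a i → a + i + 1ℤ ≡ a + (1ℤ + i)
    assoc = solve-∀
    further : ∀ b n k → b + n + k + 1ℤ ≡ b + (1ℤ + n) + k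
    further = solve-∀
    nearer : ∀ b n k → b + (1ℤ + n) + k + -1ℤ ≡ b + n + k
    nearer = solve-∀

  -- From columns with `i` nonnegative, (1,1) leads outwards along the rising boundary; from the
  -- others, (1,-1) leads inwards along the falling one. The layer `k` stays the same.
  north-staggered : Staggered (north (a , b))
  north-staggered _ (+ n , k , refl) = inj₁ (+ ℕ.suc n , k ,
    vertical≡ (assoc a (+ n)) (further b (+ n) (+ 2 * + k)))
  north-staggered _ (-[1+ n ] , k , refl) = inj₂ (suc -[1+ n ] , k ,
    vertical≡ (assoc a -[1+ n ]) (trans (nearer b (+ n) (+ 2 * + k))
      (cong (λ n → b + + n + + 2 * + k) (sym (∣suc-neg-suc∣ n)))))

  east-staggered : Staggered (east (a , b))
  east-staggered _ (+ n , k , refl) = inj₁ (+ ℕ.suc n , k ,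
    horizontal≡ (further a (+ n) (+ 2 * + k)) (assoc b (+ n)))
  east-staggered _ (-[1+ n ] , k , refl) = inj₂ (suc -[1+ n ] , k ,
    horizontal≡ (trans (nearer a (+ n) (+ 2 * + k))
      (cong (λ n → a + + n + + 2 * + k) (sym (∣suc-neg-suc∣ n)))) (assoc b -[1+ n ]))

reflect-+1 : ∀ b y → + 2 * b - 1ℤ - y + 1ℤ ≡ + 2 * b - 1ℤ - (y + -1ℤ)
reflect-+1 = solve-∀

reflect-−1 : ∀ b y → + 2 * b - 1ℤ - y + -1ℤ ≡ + 2 * b - 1ℤ - (y + 1ℤ)
reflect-−1 = solve-∀

-- The reflection exchanges the two steps allowed for a vertical domino, hence the `Sum.swap`.
south-staggered : ∀ a b → Staggered (south (a , b))
south-staggered a b _ (E , E∈north@(i , k , refl) , refl) =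
  Sum.swap (Sum.map
    (λ E′∈north → _ , E′∈north , vertical≡ refl (reflect-−1 b _))
    (λ E′∈north → _ , E′∈north , vertical≡ refl (reflect-+1 b _))
    (north-staggered a b E E∈north))

west-staggered : ∀ a b → Staggered (west (a , b))
west-staggered a b _ (E , E∈east@(j , k , refl) , refl) =
  Sum.swap (Sum.map
    (λ E′∈east → _ , E′∈east , horizontal≡ (reflect-−1 a _) refl)
    (λ E′∈east → _ , E′∈east , horizontal≡ (reflect-+1 a _) refl)
    (east-staggered a b E E∈east))

quadrants-staggered : ∀ n e s w → Staggered (north n ∪ east e ∪ south s ∪ west w)
quadrants-staggered n e s w =
  ∪-staggered (north n) _ (north-staggered (proj₁ n) (proj₂ n))
    (∪-staggered (east e) _ (east-staggered (proj₁ e) (proj₂ e))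
      (∪-staggered (south s) (west w) (south-staggered (proj₁ s) (proj₂ s))
        (west-staggered (proj₁ w) (proj₂ w))))

windmill₁-staggered : ∀ p → Staggered (windmill₁ p)
windmill₁-staggered p =
  quadrants-staggered (upperLeft p) (upperRight p) (lowerRight p) (lowerLeft p)

windmill₂-staggered : ∀ p → Staggered (windmill₂ p)
windmill₂-staggered p =
  quadrants-staggered (upperRight p) (lowerRight p) (lowerLeft p) (upperLeft p)

-- The quadrants of the first windmill around the origin; exchanging the
-- coordinates gives those of the second one.
quadrants : ∀ x y →
  (∃[ m ] y ≡ + ∣ suc x ∣ + + m) ⊎ (∃[ m ] x ≡ + ∣ y ∣ + + m) ⊎
  (∃[ m ] y ≡ -1ℤ - (+ ∣ x ∣ + + m)) ⊎ (∃[ m ] x ≡ -1ℤ - (+ ∣ suc y ∣ + + m))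
quadrants (+ x) (+ y) with ℕ.≤-<-connex y x
... | inj₁ y≤x = let m , p = ℕ.m≤n⇒∃[o]m+o≡n y≤x in inj₂ (inj₁ (m , cong +_ (sym p)))
... | inj₂ x<y = let m , p = ℕ.m≤n⇒∃[o]m+o≡n x<y in inj₁ (m , cong +_ (sym p))
quadrants (+ x) -[1+ y ] with ℕ.≤-<-connex x y
... | inj₁ x≤y = let m , p = ℕ.m≤n⇒∃[o]m+o≡n x≤y in
  inj₂ (inj₂ (inj₁ (m , trans (cong -[1+_] (sym p)) (neg-suc _))))
... | inj₂ y<x = let m , p = ℕ.m≤n⇒∃[o]m+o≡n y<x in inj₂ (inj₁ (m , cong +_ (sym p)))
quadrants -[1+ x ] (+ y) with ℕ.≤-<-connex x y
... | inj₁ x≤y = let m , p = ℕ.m≤n⇒∃[o]m+o≡n x≤y in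
  inj₁ (m , cong +_ (trans (sym p) (cong (ℕ._+ m) (sym (∣suc-neg-suc∣ x)))))
... | inj₂ y<x = let m , p = ℕ.m≤n⇒∃[o]m+o≡n y<x in
  inj₂ (inj₂ (inj₂ (m , trans (cong -[1+_] (sym p)) (neg-suc _))))
quadrants -[1+ x ] -[1+ y ] with ℕ.≤-<-connex y x
... | inj₁ y≤x = let m , p = ℕ.m≤n⇒∃[o]m+o≡n y≤x in
  inj₂ (inj₂ (inj₂ (m ,
    trans (cong -[1+_] (trans (sym p) (cong (ℕ._+ m) (sym (∣suc-neg-suc∣ y))))) (neg-suc _))))
... | inj₂ x<y = let m , p = ℕ.m≤n⇒∃[o]m+o≡n x<y in
  inj₂ (inj₂ (inj₁ (m , trans (cong -[1+_] (sym p)) (neg-suc _))))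

offset : ∀ a x → x ≡ a + (x - a)
offset = solve-∀

level : ∀ a x → x ≡ a + 0ℤ + (x - a)
level = solve-∀

beyond : ∀ a x → x ≡ a + -1ℤ + (1ℤ + (x - a))
beyond = solve-∀

before : ∀ a x {n} → x - a ≡ -1ℤ - n → x ≡ a + -1ℤ - n
before a x {n} p = trans (offset a x) (trans (cong (_+_ a) p) (assoc a n))
  where
  assoc : ∀ a n → a + (-1ℤ - n) ≡ a + -1ℤ - n
  assoc = solve-∀

windmill₁-covers : ∀ p x y → Covers (windmill₁ p) x y
windmill₁-covers (a , b) x y with quadrants (x - a) (y - b)
... | inj₁ (m , p) = map₂ inj₁ (north-covers (a + -1ℤ) (b + 0ℤ) (suc (x - a)) m
        (beyond a x) (trans (level b y) (cong (_+_ (b + 0ℤ)) p)))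
... | inj₂ (inj₁ (m , p)) = map₂ (inj₂ ∘ inj₁) (east-covers a b (y - b) m
        (offset b y) (trans (offset a x) (cong (_+_ a) p)))
... | inj₂ (inj₂ (inj₁ (m , p))) = map₂ (inj₂ ∘ inj₂ ∘ inj₁)
        (south-covers (a + 0ℤ) (b + -1ℤ) (x - a) m (level a x) (before b y p))
... | inj₂ (inj₂ (inj₂ (m , p))) = map₂ (inj₂ ∘ inj₂ ∘ inj₂)
        (west-covers (a + -1ℤ) (b + -1ℤ) (suc (y - b)) m (beyond b y) (before a x p))

windmill₂-covers : ∀ p x y → Covers (windmill₂ p) x y
windmill₂-covers (a , b) x y with quadrants (y - b) (x - a)
... | inj₁ (m , p) = map₂ (inj₂ ∘ inj₁) (east-covers (a + 0ℤ) (b + -1ℤ) (suc (y - b)) m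
        (beyond b y) (trans (level a x) (cong (_+_ (a + 0ℤ)) p)))
... | inj₂ (inj₁ (m , p)) = map₂ inj₁ (north-covers a b (x - a) m
        (offset a x) (trans (offset b y) (cong (_+_ b) p)))
... | inj₂ (inj₂ (inj₁ (m , p))) = map₂ (inj₂ ∘ inj₂ ∘ inj₂)
        (west-covers (a + -1ℤ) (b + 0ℤ) (y - b) m (level b y) (before a x p))
... | inj₂ (inj₂ (inj₂ (m , p))) = map₂ (inj₂ ∘ inj₂ ∘ inj₁)
        (south-covers (a + -1ℤ) (b + -1ℤ) (suc (x - a)) m (beyond a x) (before b y p))

upend turn : Direction → Direction
upend d = transpose (mirror (transpose d))
turn d = transpose (mirror d)

-- `upended` is the reflection `y ↦ - y`, taking south tips to north tips; `turned` is the quarter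
-- turn taking west tips to north tips.
upended turned : Field → Field
upended f = transposed (mirrored (transposed f))
turned  f = transposed (mirrored f)

upended-flipFree : ∀ {f} → FlipFree f → FlipFree (upended f)
upended-flipFree φ = transposed-flipFree (mirrored-flipFree (transposed-flipFree φ))

turned-flipFree : ∀ {f} → FlipFree f → FlipFree (turned f)
turned-flipFree φ = transposed-flipFree (mirrored-flipFree φ)

x-1+1 : ∀ x → x + -1ℤ + 1ℤ ≡ x
x-1+1 = solve-∀

x+0≡x-1+1 : ∀ x → x + 0ℤ ≡ x + -1ℤ + 1ℤ
x+0≡x-1+1 = solve-∀

x+0-1 : ∀ x → x + 0ℤ + -1ℤ ≡ x + -1ℤ
x+0-1 = solve-∀

-- The direction field of a tiling

module Tiling (em : ExcludedMiddle 0ℓ) {t : Pred Domino 0ℓ} (τ : IsTiling t) where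
  open IsTiling τ

  same-domino : ∀ {D E S} → D ∈ t → E ∈ t → S ∈ squares D → S ∈ squares E → D ≡ E
  same-domino {D} {E} D∈t E∈t S∈D S∈E with em {P = D ≡ E}
  ... | yes D≡E = D≡E
  ... | no  D≢E = ⊥-elim (disjoint D∈t E∈t D≢E (S∈D , S∈E))

  direction : Field
  direction x y with covering (x , y)
  ... | D , _ , S∈D = proj₁ (covered⇒dominoAt D S∈D)

  private
    f : Field
    f = direction

  placed : ∀ {d x y} → f x y ≡ d → dominoAt d x y ∈ t
  placed {x = x} {y} refl with covering (x , y)
  ... | D , D∈t , S∈D = subst t (proj₂ (covered⇒dominoAt D S∈D)) D∈t

  -- The domino that `covering` selects is the only one over the square, by disjointness, so any
  -- domino of `t` found there determines the direction.
  directed : ∀ {d x y} → dominoAt d x y ∈ t → f x y ≡ d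
  directed {d} {x} {y} D∈t = dominoAt-injective (f x y) d
    (same-domino (placed refl) D∈t (dominoAt-covers (f x y) x y) (dominoAt-covers d x y))

  directed′ : ∀ d {x y D} → D ≡ dominoAt d x y → D ∈ t → f x y ≡ d
  directed′ _ refl = directed

  matching : Matching f
  matching = record
    { right⇒left = λ {x} {y} p →
        directed′ left (horizontal≡ (sym (pred-suc x)) refl) (placed p)
    ; left⇒right = λ p → directed (placed p)
    ; up⇒down    = λ {x} {y} p →
        directed′ down (vertical≡ refl (sym (pred-suc y))) (placed p)
    ; down⇒up    = λ p → directed (placed p)
    }

  open Matching matching

  ¬admitsFlip⇒flipFree : ¬ AdmitsFlip t → FlipFree f
  ¬admitsFlip⇒flipFree ¬flip = record
    { matching = matching
    ; ¬right²  = λ {x} {y} p q → ¬flip (_ , _ , placed p , placed q , refl ,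
        (x , y) , (λ {S} → horizontal⊆ {x} {y} {S}) , λ {S} → horizontal⊇ {x} {y} {S})
    ; ¬up²     = λ {x} {y} p q → ¬flip (_ , _ , placed p , placed q , refl ,
        (x , y) , (λ {S} → vertical⊆ {x} {y} {S}) , λ {S} → vertical⊇ {x} {y} {S})
    }
    where
    suc≡ : ∀ x → 1ℤ + x ≡ x + 1ℤ
    suc≡ = solve-∀
    suc+0≡ : ∀ x → 1ℤ + x + 0ℤ ≡ x + 1ℤ
    suc+0≡ = solve-∀
    horizontal⊆ : ∀ {x y} → squares (dominoAt right x y) ∪ squares (dominoAt right x (suc y)) ⊆
      block (x , y)
    horizontal⊆ (inj₁ (inj₁ p)) = inj₁ p
    horizontal⊆ (inj₁ (inj₂ p)) = inj₂ (inj₁ p)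
    horizontal⊆ {x} {y} (inj₂ (inj₁ p)) =
      inj₂ (inj₂ (inj₁ (trans (cong₂ _,_ (x+0 x) (sym (suc≡ y))) p)))
    horizontal⊆ {x} {y} (inj₂ (inj₂ p)) =
      inj₂ (inj₂ (inj₂ (trans (cong₂ _,_ refl (sym (suc+0≡ y))) p)))
    horizontal⊇ : ∀ {x y} → block (x , y) ⊆
      squares (dominoAt right x y) ∪ squares (dominoAt right x (suc y))
    horizontal⊇ (inj₁ p) = inj₁ (inj₁ p)
    horizontal⊇ (inj₂ (inj₁ p)) = inj₁ (inj₂ p)
    horizontal⊇ {x} {y} (inj₂ (inj₂ (inj₁ p))) =
      inj₂ (inj₁ (trans (cong₂ _,_ (sym (x+0 x)) (suc≡ y)) p))
    horizontal⊇ {x} {y} (inj₂ (inj₂ (inj₂ p))) = inj₂ (inj₂ (trans (cong₂ _,_ refl (suc+0≡ y)) p))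
    vertical⊆ : ∀ {x y} → squares (dominoAt up x y) ∪ squares (dominoAt up (suc x) y) ⊆
      block (x , y)
    vertical⊆ (inj₁ (inj₁ p)) = inj₁ p
    vertical⊆ (inj₁ (inj₂ p)) = inj₂ (inj₂ (inj₁ p))
    vertical⊆ {x} {y} (inj₂ (inj₁ p)) = inj₂ (inj₁ (trans (cong₂ _,_ (sym (suc≡ x)) (x+0 y)) p))
    vertical⊆ {x} {y} (inj₂ (inj₂ p)) =
      inj₂ (inj₂ (inj₂ (trans (cong₂ _,_ (sym (suc+0≡ x)) refl) p)))
    vertical⊇ : ∀ {x y} → block (x , y) ⊆
      squares (dominoAt up x y) ∪ squares (dominoAt up (suc x) y)
    vertical⊇ (inj₁ p) = inj₁ (inj₁ p)
    vertical⊇ {x} {y} (inj₂ (inj₁ p)) = inj₂ (inj₁ (trans (cong₂ _,_ (suc≡ x) (sym (x+0 y))) p))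
    vertical⊇ (inj₂ (inj₂ (inj₁ p))) = inj₁ (inj₂ p)
    vertical⊇ {x} {y} (inj₂ (inj₂ (inj₂ p))) = inj₂ (inj₂ (trans (cong₂ _,_ (suc+0≡ x) refl) p))

  -- Staggered tilings admit no flip

  staggered⇒¬right² : Staggered t → ∀ {x y} → f x y ≡ right → f x (suc y) ≢ right
  staggered⇒¬right² stagger {x} {y} p q with stagger _ (placed p)
  ... | inj₁ D∈t = clash (directed′ right (horizontal≡ (+-comm x 1ℤ) (+-comm y 1ℤ)) D∈t)
                         (right⇒left q) λ ()
  ... | inj₂ D∈t = clash (right⇒left (directed′ right (horizontal≡ (+-comm x -1ℤ) (+-comm y 1ℤ)) D∈t))
                         (at f (sym (suc-pred x)) refl q) λ ()

  staggered⇒¬up² : Staggered t → ∀ {x y} → f x y ≡ up → f (suc x) y ≢ up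
  staggered⇒¬up² stagger {x} {y} p q with stagger _ (placed p)
  ... | inj₁ D∈t = clash (directed′ up (vertical≡ (+-comm x 1ℤ) (+-comm y 1ℤ)) D∈t)
                         (up⇒down q) λ ()
  ... | inj₂ D∈t = clash (up⇒down (directed′ up (vertical≡ (+-comm x 1ℤ) (+-comm y -1ℤ)) D∈t))
                         (at f refl (sym (suc-pred y)) q) λ ()

  -- If `(x , h)` were the right half of `D`, the corner of `D` would lie one column to the left of
  -- the block.
  left-column : ∀ {D x y h} → D ∈ t → orientation D ≡ horizontal → (x , h) ∈ squares D →
    corner D ∈ block (x , y) → f x h ≡ right
  left-column {domino horizontal c} D∈t refl (inj₁ refl) _ = directed D∈t
  left-column {domino horizontal (a , b)} D∈t refl (inj₂ refl) corner∈ =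
    ⊥-elim (excluded corner∈)
    where
    excluded : ∀ {y} → (a , b) ∈ block (a + 1ℤ , y) → Empty
    excluded (inj₁ p) = x+m≢x (λ ()) (cong proj₁ p)
    excluded (inj₂ (inj₁ p)) = x+m≢x (λ ()) (trans (sym (+-assoc a 1ℤ 1ℤ)) (cong proj₁ p))
    excluded (inj₂ (inj₂ (inj₁ p))) = x+m≢x (λ ()) (trans (sym (+-assoc a 1ℤ 0ℤ)) (cong proj₁ p))
    excluded (inj₂ (inj₂ (inj₂ p))) = x+m≢x (λ ()) (trans (sym (+-assoc a 1ℤ 1ℤ)) (cong proj₁ p))

  bottom-row : ∀ {D x y h} → D ∈ t → orientation D ≡ vertical → (h , y) ∈ squares D →
    corner D ∈ block (x , y) → f h y ≡ up
  bottom-row {domino vertical c} D∈t refl (inj₁ refl) _ = directed D∈t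
  bottom-row {domino vertical (a , b)} D∈t refl (inj₂ refl) corner∈ =
    ⊥-elim (excluded corner∈)
    where
    excluded : ∀ {x} → (a , b) ∈ block (x , b + 1ℤ) → Empty
    excluded (inj₁ p) = x+m≢x (λ ()) (cong proj₂ p)
    excluded (inj₂ (inj₁ p)) = x+m≢x (λ ()) (trans (sym (+-assoc b 1ℤ 0ℤ)) (cong proj₂ p))
    excluded (inj₂ (inj₂ (inj₁ p))) = x+m≢x (λ ()) (trans (sym (+-assoc b 1ℤ 1ℤ)) (cong proj₂ p))
    excluded (inj₂ (inj₂ (inj₂ p))) = x+m≢x (λ ()) (trans (sym (+-assoc b 1ℤ 1ℤ)) (cong proj₂ p))

  -- `AdmitsFlip` does not tell which domino is the lower or left one, so each square of the left
  -- column, or of the bottom row, is looked up in whichever domino covers it.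
  staggered⇒¬admitsFlip : Staggered t → ¬ AdmitsFlip t
  staggered⇒¬admitsFlip stagger
    (domino horizontal c , domino .horizontal e , D∈t , E∈t , refl , (x , y) , ⊆block , block⊆) =
    staggered⇒¬right² stagger (column (block⊆ (inj₁ refl)))
      (at f (x+0 x) (+-comm y 1ℤ) (at f (sym (x+0 x)) refl (column
        (block⊆ (inj₂ (inj₂ (inj₁ (cong₂ _,_ (x+0 x) refl))))))))
    where
    column : ∀ {h} → (x , h) ∈ squares (domino horizontal c) ∪ squares (domino horizontal e) →
      f x h ≡ right
    column (inj₁ S∈D) = left-column D∈t refl S∈D (⊆block (inj₁ (inj₁ refl)))
    column (inj₂ S∈E) = left-column E∈t refl S∈E (⊆block (inj₂ (inj₁ refl)))
  staggered⇒¬admitsFlip stagger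
    (domino vertical c , domino .vertical e , D∈t , E∈t , refl , (x , y) , ⊆block , block⊆) =
    staggered⇒¬up² stagger (row (block⊆ (inj₁ refl)))
      (at f (+-comm x 1ℤ) refl (row (block⊆ (inj₂ (inj₁ (cong₂ _,_ refl (x+0 y)))))))
    where
    row : ∀ {h} → (h , y) ∈ squares (domino vertical c) ∪ squares (domino vertical e) → f h y ≡ up
    row (inj₁ S∈D) = bottom-row D∈t refl S∈D (⊆block (inj₁ (inj₁ refl)))
    row (inj₂ S∈E) = bottom-row E∈t refl S∈E (⊆block (inj₂ (inj₁ refl)))

  -- Staircases and invariance

  invariant⇒translates : ∀ s → Invariant s f → ∀ {D} k → D ∈ t → translate (k • step s) D ∈ t
  invariant⇒translates s inv {D} k D∈t with covered⇒dominoAt D (inj₁ refl)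
  ... | d , D≡ = subst t (sym (trans (cong (translate (k • step s)) D≡)
                   (translate-dominoAt d x y (k * u) (k * v))))
      (placed (trans (along k) (directed′ d D≡ D∈t)))
    where
    x y u v : ℤ
    x = proj₁ (corner D)
    y = proj₂ (corner D)
    u = proj₁ (step s)
    v = proj₂ (step s)
    along : ∀ k → f (x + k * u) (y + k * v) ≡ f x y
    along = ℤ-induction _ (cong₂ f (x+0 x) (x+0 y))
      (λ k e → trans (trans (cong₂ f (next x k u) (next y k v)) (inv _ _)) e)
      (λ k e → trans (trans (sym (inv _ _)) (cong₂ f (prev x k u) (prev y k v))) e)
      where
      next : ∀ x k u → x + (1ℤ + k) * u ≡ x + k * u + u
      next = solve-∀
      prev : ∀ x k u → x + (-1ℤ + k) * u + u ≡ x + k * u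
      prev = solve-∀

  invariant⇒staircases : ∀ s → Invariant s f → ConsistsOfParallelStaircases t
  invariant⇒staircases s inv = s , Base , separate , (λ {D} → split {D}) ,
    λ { (D , (D∈t , _) , k , refl) → invariant⇒translates s inv k D∈t }
    where
    -- Both steps have first component 1, so a staircase has exactly one corner
    -- on the axis.
    Base : Pred Domino 0ℓ
    Base D = D ∈ t × proj₁ (corner D) ≡ 0ℤ
    step₁ : ∀ s → proj₁ (step s) ≡ 1ℤ
    step₁ rising  = refl
    step₁ falling = refl
    coefficient : ∀ {s a a′} k l → a ≡ 0ℤ → a′ ≡ 0ℤ →
      a + k * proj₁ (step s) ≡ a′ + l * proj₁ (step s) → k ≡ l
    coefficient {s} k l refl refl p rewrite step₁ s = trans (lemma k) (trans p (sym (lemma l)))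
      where
      lemma : ∀ k → k ≡ 0ℤ + k * 1ℤ
      lemma = solve-∀
    +-cancel : ∀ {x y} z → x + z ≡ y + z → x ≡ y
    +-cancel {x} {y} z p = trans (lemma x z) (trans (cong (_- z) p) (sym (lemma y z)))
      where
      lemma : ∀ x z → x ≡ x + z - z
      lemma = solve-∀
    separate : ∀ {D E} → D ∈ Base → E ∈ Base → D ≢ E → staircase s D ⊥ staircase s E
    separate {domino o (a , b)} {domino o′ (a′ , b′)} (_ , a≡0) (_ , a′≡0) D≢E ((k , refl) , l , p)
      with coefficient {s} k l a≡0 a′≡0 (cong (proj₁ ∘ corner) p)
    ... | refl = D≢E (cong₂ domino (cong orientation p)
      (cong₂ _,_ (trans a≡0 (sym a′≡0))
        (+-cancel (k * proj₂ (step s)) (cong (proj₂ ∘ corner) p))))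
    split : t ⊆ (λ E → ∃[ D ] D ∈ Base × E ∈ staircase s D)
    -- Moving back by `a` steps puts the corner on the axis; `a` is then the index of the given
    -- domino in its staircase.
    split {domino o (a , b)} D∈t = _ ,
      (invariant⇒translates s inv (- a) D∈t , trans (cong (λ u → a + - a * u) (step₁ s)) (onAxis a)) ,
      a , cong₂ (λ x y → domino o (x , y)) (back a a (proj₁ (step s))) (back b a (proj₂ (step s)))
      where
      onAxis : ∀ a → a + - a * 1ℤ ≡ 0ℤ
      onAxis = solve-∀
      back : ∀ b a u → b ≡ b + - a * u + a * u
      back = solve-∀

  staircases⇒invariant : (σ : ConsistsOfParallelStaircases t) → Invariant (proj₁ σ) f
  staircases⇒invariant (s , B , _ , t⊆ , ⊆t) x y =
    directed′ (f x y) (translate-dominoAt (f x y) x y _ _) (forward (placed refl))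
    where
    next : ∀ x k u → x + k * u + u ≡ x + (1ℤ + k) * u
    next = solve-∀
    forward : ∀ {D} → D ∈ t → translate (step s) D ∈ t
    forward D∈t with t⊆ D∈t
    ... | domino o (a , b) , D∈B , k , refl = ⊆t (_ , D∈B , suc k ,
      cong₂ (λ x y → domino o (x , y)) (next a k _) (next b k _))

  staircases⇒staggered : ConsistsOfParallelStaircases t → Staggered t
  staircases⇒staggered σ@(rising , _) (domino _ (x , y)) D∈t = inj₁
    (invariant⇒translates rising (staircases⇒invariant σ) 1ℤ D∈t)
  -- For horizontal dominoes `aside` is the falling step taken backwards, hence `-1ℤ`.
  staircases⇒staggered σ@(falling , _) (domino horizontal (x , y)) D∈t = inj₂
    (invariant⇒translates falling (staircases⇒invariant σ) -1ℤ D∈t)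
  staircases⇒staggered σ@(falling , _) (domino vertical (x , y)) D∈t = inj₂
    (invariant⇒translates falling (staircases⇒invariant σ) 1ℤ D∈t)

  -- From a core to the whole windmill

  module Windmill (φ : FlipFree f) (a b : ℤ) where

    private
      out : ∀ b v n k → b + (v + (n + k)) ≡ b + v + n + k
      out = solve-∀
      out⁻ : ∀ b v n k → -1ℤ + (b + (v + - (n + k))) ≡ + 2 * (b + v) - 1ℤ - (b + v + n + k)
      out⁻ = solve-∀

      g : Field
      g = shift a b f

      around : ∀ u v → FlipFree (shift u v g)
      around u v = shift-flipFree u v (shift-flipFree a b φ)

    -- The tip gets its own names `c` and `d` because `upperRight p` is `p` itself, while `a + 0ℤ`
    -- does not reduce to `a`.
    north⊆ : ∀ {u v c d} → a + u ≡ c → b + v ≡ d →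
      Tip (shift u v g) → north (c , d) ⊆ t
    north⊆ {u} {v} refl refl tip (i , k , refl) =
      subst t (vertical≡ (sym (+-assoc a u i)) (out b v (+ ∣ i ∣) (+ 2 * + k)))
        (placed (tip-fill (around u v) tip i k))

    east⊆ : ∀ {u v c d} → a + u ≡ c → b + v ≡ d →
      Tip (transposed (shift u v g)) → east (c , d) ⊆ t
    east⊆ {u} {v} refl refl tip (j , k , refl) =
      subst t (horizontal≡ (out a u (+ ∣ j ∣) (+ 2 * + k)) (sym (+-assoc b v j)))
        (placed (untranspose (tip-fill (transposed-flipFree (around u v)) tip j k)))

    south⊆ : ∀ {u v c d} → a + u ≡ c → b + v ≡ d →
      Tip (upended (shift u v g)) → south (c , d) ⊆ t
    south⊆ {u} {v} refl refl tip (_ , (i , k , refl) , refl) =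
      subst t (vertical≡ (sym (+-assoc a u i)) (out⁻ b v (+ ∣ i ∣) (+ 2 * + k)))
        (placed (untranspose (unmirror (untranspose
          (tip-fill (upended-flipFree (around u v)) tip i k)))))

    west⊆ : ∀ {u v c d} → a + u ≡ c → b + v ≡ d →
      Tip (turned (shift u v g)) → west (c , d) ⊆ t
    west⊆ {u} {v} refl refl tip (_ , (j , k , refl) , refl) =
      subst t (horizontal≡ (out⁻ a u (+ ∣ j ∣) (+ 2 * + k)) (sym (+-assoc b v j)))
        (placed (unmirror (untranspose
          (tip-fill (turned-flipFree (around u v)) tip j k))))

    -- Each quadrant is brought to the north by a symmetry. `transposed` and `upended` reverse the
    -- sense of rotation and `turned` keeps it, which decides between `tip-above-left` and
    -- `tip-above-right`.
    core₁⇒⊆ : Core₁ g → windmill₁ (a , b) ⊆ t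
    core₁⇒⊆ (n , e , s , w) (inj₁ D∈) = north⊆ { -1ℤ} {0ℤ} refl refl
      (tip-above-left (around -1ℤ 0ℤ) n e w) D∈
    core₁⇒⊆ (n , e , s , w) (inj₂ (inj₁ D∈)) = east⊆ {0ℤ} {0ℤ} (x+0 a) (x+0 b)
      (tip-above-right (transposed-flipFree (around 0ℤ 0ℤ))
        (cong transpose e) (cong transpose s) (cong transpose n)) D∈
    core₁⇒⊆ (n , e , s , w) (inj₂ (inj₂ (inj₁ D∈))) = south⊆ {0ℤ} { -1ℤ} refl refl
      (tip-above-right (upended-flipFree (around 0ℤ -1ℤ))
        (cong upend s) (cong upend w) (cong upend e)) D∈
    core₁⇒⊆ (n , e , s , w) (inj₂ (inj₂ (inj₂ D∈))) = west⊆ { -1ℤ} { -1ℤ} refl refl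
      (tip-above-left (turned-flipFree (around -1ℤ -1ℤ))
        (cong turn w) (cong turn n) (cong turn s)) D∈

    core₂⇒⊆ : Core₂ g → windmill₂ (a , b) ⊆ t
    core₂⇒⊆ (n , e , s , w) (inj₁ D∈) = north⊆ {0ℤ} {0ℤ} (x+0 a) (x+0 b)
      (tip-above-right (around 0ℤ 0ℤ) n w e) D∈
    core₂⇒⊆ (n , e , s , w) (inj₂ (inj₁ D∈)) = east⊆ {0ℤ} { -1ℤ} refl refl
      (tip-above-left (transposed-flipFree (around 0ℤ -1ℤ))
        (cong transpose e) (cong transpose n) (cong transpose s)) D∈
    core₂⇒⊆ (n , e , s , w) (inj₂ (inj₂ (inj₁ D∈))) = south⊆ { -1ℤ} { -1ℤ} refl refl
      (tip-above-left (upended-flipFree (around -1ℤ -1ℤ))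
        (cong upend s) (cong upend e) (cong upend w)) D∈
    core₂⇒⊆ (n , e , s , w) (inj₂ (inj₂ (inj₂ D∈))) = west⊆ { -1ℤ} {0ℤ} refl refl
      (tip-above-right (turned-flipFree (around -1ℤ 0ℤ))
        (cong turn w) (cong turn s) (cong turn n)) D∈

  -- The domino of `P` over the corner of a given domino of `t` also belongs to `t`, so the two
  -- coincide.
  covers⇒≐ : ∀ {P} → P ⊆ t → (∀ x y → Covers P x y) → t ≐ P
  covers⇒≐ {P} P⊆t covers = t⊆P , P⊆t
    where
    t⊆P : t ⊆ P
    t⊆P {domino o (x , y)} D∈t with covers x y
    ... | d , E∈P = subst P (same-domino (P⊆t E∈P) D∈t (dominoAt-covers d x y) (inj₁ refl)) E∈P

  core⇒windmill : FlipFree f → HasCore f → IsWindmill t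
  core⇒windmill φ (a , b , inj₁ c) = (a , b) ,
    inj₁ (covers⇒≐ (Windmill.core₁⇒⊆ φ a b c) (windmill₁-covers (a , b)))
  core⇒windmill φ (a , b , inj₂ c) = (a , b) ,
    inj₂ (covers⇒≐ (Windmill.core₂⇒⊆ φ a b c) (windmill₂-covers (a , b)))

  windmill⇒staggered : IsWindmill t → Staggered t
  windmill⇒staggered (p , inj₁ (t⊆ , ⊆t)) D D∈t = Sum.map ⊆t ⊆t (windmill₁-staggered p D (t⊆ D∈t))
  windmill⇒staggered (p , inj₂ (t⊆ , ⊆t)) D D∈t = Sum.map ⊆t ⊆t (windmill₂-staggered p D (t⊆ D∈t))

  north-tip : ∀ a b → north (a , b) ⊆ t → f a b ≡ up
  north-tip a b ⊆t = directed′ up refl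
    (⊆t (0ℤ , 0 , vertical≡ (sym (x+0 a)) (sym (trans (x+0 _) (x+0 b)))))

  east-tip : ∀ a b → east (a , b) ⊆ t → f a b ≡ right
  east-tip a b ⊆t = directed′ right refl
    (⊆t (0ℤ , 0 , horizontal≡ (sym (trans (x+0 _) (x+0 a))) (sym (x+0 b))))

  tip⁻ : ∀ b → -1ℤ + b ≡ + 2 * b - 1ℤ - (b + 0ℤ + 0ℤ)
  tip⁻ = solve-∀

  south-tip : ∀ a b → south (a , b) ⊆ t → f a b ≡ down
  south-tip a b ⊆t = directed′ down refl
    (⊆t (_ , (0ℤ , 0 , refl) , vertical≡ (sym (x+0 a)) (tip⁻ b)))

  west-tip : ∀ a b → west (a , b) ⊆ t → f a b ≡ left
  west-tip a b ⊆t = directed′ left refl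
    (⊆t (_ , (0ℤ , 0 , refl) , horizontal≡ (tip⁻ a) (sym (x+0 b))))

  -- The invariance carries a tip of the windmill to the opposite one.
  invariant⇒¬windmill : ∀ s → Invariant s f → ¬ IsWindmill t
  invariant⇒¬windmill rising inv ((a , b) , inj₁ (_ , ⊆t)) = clash
    (trans (cong₂ f (sym (x-1+1 a)) (sym (x-1+1 b))) (trans (inv (a + -1ℤ) (b + -1ℤ))
      (west-tip (a + -1ℤ) (b + -1ℤ) (⊆t ∘ inj₂ ∘ inj₂ ∘ inj₂))))
    (east-tip a b (⊆t ∘ inj₂ ∘ inj₁)) λ ()
  invariant⇒¬windmill rising inv ((a , b) , inj₂ (_ , ⊆t)) = clash
    (trans (cong₂ f (sym (x-1+1 a)) (sym (x-1+1 b))) (trans (inv (a + -1ℤ) (b + -1ℤ))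
      (south-tip (a + -1ℤ) (b + -1ℤ) (⊆t ∘ inj₂ ∘ inj₂ ∘ inj₁))))
    (north-tip a b (⊆t ∘ inj₁)) λ ()
  invariant⇒¬windmill falling inv ((a , b) , inj₁ (_ , ⊆t)) = clash
    (trans (cong₂ f (x+0≡x-1+1 a) (sym (x+0-1 b))) (trans (inv (a + -1ℤ) (b + 0ℤ))
      (north-tip (a + -1ℤ) (b + 0ℤ) (⊆t ∘ inj₁))))
    (south-tip (a + 0ℤ) (b + -1ℤ) (⊆t ∘ inj₂ ∘ inj₂ ∘ inj₁)) λ ()
  invariant⇒¬windmill falling inv ((a , b) , inj₂ (_ , ⊆t)) = clash
    (trans (cong₂ f (x+0≡x-1+1 a) (sym (x+0-1 b))) (trans (inv (a + -1ℤ) (b + 0ℤ))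
      (west-tip (a + -1ℤ) (b + 0ℤ) (⊆t ∘ inj₂ ∘ inj₂ ∘ inj₂))))
    (east-tip (a + 0ℤ) (b + -1ℤ) (⊆t ∘ inj₂ ∘ inj₁)) λ ()

theorem2 : ExcludedMiddle 0ℓ →
    (t : Pred Domino 0ℓ) → IsTiling t →
    Tri (AdmitsFlip t) (ConsistsOfParallelStaircases t) (IsWindmill t)
theorem2 em t τ with em {P = AdmitsFlip t}
... | yes flip = tri< flip
  (λ staircases → staggered⇒¬admitsFlip (staircases⇒staggered staircases) flip)
  (λ windmill → staggered⇒¬admitsFlip (windmill⇒staggered windmill) flip)
  where open Tiling em τ
... | no ¬flip = classify (flipFree⇒core⊎falling⊎rising em φ)
  where
  open Tiling em τ
  φ : FlipFree direction
  φ = ¬admitsFlip⇒flipFree ¬flip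
  invariant : ∀ s → Invariant s direction →
    Tri (AdmitsFlip t) (ConsistsOfParallelStaircases t) (IsWindmill t)
  invariant s inv = tri≈ ¬flip (invariant⇒staircases s inv) (invariant⇒¬windmill s inv)
  classify : HasCore direction ⊎ Falling direction ⊎ Rising direction →
    Tri (AdmitsFlip t) (ConsistsOfParallelStaircases t) (IsWindmill t)
  classify (inj₁ core) = tri> ¬flip
    (λ staircases → invariant⇒¬windmill (proj₁ staircases) (staircases⇒invariant staircases)
      (core⇒windmill φ core))
    (core⇒windmill φ core)
  classify (inj₂ (inj₁ inv)) = invariant falling λ x y →
    trans (cong₂ direction (+-comm x 1ℤ) (+-comm y -1ℤ)) (inv x y)
  classify (inj₂ (inj₂ inv)) = invariant rising λ x y →
    trans (cong₂ direction (+-comm x 1ℤ) (+-comm y 1ℤ)) (inv x y)
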